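{- There is no semi-planar function $f:\mathbb{Z}_6\to\mathbb{Z}_6$.
   Context: $\mathbb{Z}_6$ denotes the additive cyclic group of integers modulo $6$. A function $f:\mathbb{Z}_6\to\mathbb{Z}_6$ is semi-planar if for every non-zero $a\in\mathbb{Z}_6$ and every $y\in\mathbb{Z}_6$, the equation $f(x+a)-f(x)=y$ has either $0$ or $2$ solutions $x\in\mathbb{Z}_6$. -}

module Defs where

open import Data.Fin using (Fin; zero; toℕ; _≟_)
open import Data.List using (List; length; filter; allFin)
open import Data.Nat using (ℕ; _+_; _∸_)
open import Data.Nat.DivMod using (_mod_)
open import Data.Sum using (_⊎_)
open import Relation.Binary.PropositionalEquality using (_≡_; _≢_)

ℤ₆ : Set
ℤ₆ = Fin 6

infixl 6 _⊕_ _⊖_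

_⊕_ : ℤ₆ → ℤ₆ → ℤ₆
x ⊕ y = (toℕ x + toℕ y) mod 6

-- The representative 6 - y is positive because y < 6, so ∸ never truncates.
_⊖_ : ℤ₆ → ℤ₆ → ℤ₆
x ⊖ y = (toℕ x + (6 ∸ toℕ y)) mod 6

-- allFin 6 lists each element of ℤ₆ exactly once, so the length of this
-- list is the number of solutions.
solutions : (ℤ₆ → ℤ₆) → ℤ₆ → ℤ₆ → List ℤ₆
solutions f a y = filter (λ x → f (x ⊕ a) ⊖ f x ≟ y) (allFin 6)

SemiPlanar : (ℤ₆ → ℤ₆) → Set
SemiPlanar f = ∀ (a : ℤ₆) → a ≢ zero → ∀ (y : ℤ₆) →
  length (solutions f a y) ≡ 0 ⊎ length (solutions f a y) ≡ 2

-- Semi-planarity depends only on the differences of values of f, so f may be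
-- translated to satisfy f(0) = 0; the remaining 6⁵ functions are checked
-- exhaustively.

module Submission where

open import Defs
open import Data.Fin using (Fin; zero; suc; _≟_)
open import Data.Fin.Properties using (all?)
open import Data.List using (length; allFin)
open import Data.List.Properties using (filter-≐)
open import Data.Nat as ℕ using (zero; suc)
open import Data.Product using (∃-syntax; _,_)
open import Data.Sum as Sum using ()
open import Data.Vec using (Vec; []; _∷_; lookup; tabulate)
open import Data.Vec.Properties using (lookup∘tabulate)
open import Relation.Binary.PropositionalEquality
  using (_≡_; refl; sym; trans; cong; cong₂)
open import Relation.Nullary using (¬_; Dec)
open import Relation.Nullary.Decidable
  using (map′; ¬?; _→-dec_; _⊎-dec_; from-yes)
open import Relation.Unary using (Pred; Decidable)

-- Replacing f by f - f(0) leaves every difference, hence every solution set, unchanged, so f(0) = 0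
-- may be assumed. Such an f is a table of five values, and semi-planarity of a table is decidable,
-- so evaluation settles all 7776 cases.

allVec? : ∀ {k p} n {P : Pred (Vec (Fin k) n) p} → Decidable P → Dec (∀ v → P v)
allVec? zero    P? = map′ (λ { p [] → p }) (λ p → p []) (P? [])
allVec? (suc n) P? = map′ (λ { p (x ∷ v) → p x v }) (λ p x v → p (x ∷ v))
  (all? λ x → allVec? n λ v → P? (x ∷ v))

semiPlanar? : Decidable SemiPlanar
semiPlanar? f = all? λ a → ¬? (a ≟ zero) →-dec all? λ y →
  (length (solutions f a y) ℕ.≟ 0) ⊎-dec (length (solutions f a y) ℕ.≟ 2)

⊖-self : ∀ x → x ⊖ x ≡ zero
⊖-self = from-yes (all? λ x → x ⊖ x ≟ zero)

⊖-translate : ∀ x y c → (x ⊖ c) ⊖ (y ⊖ c) ≡ x ⊖ y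
⊖-translate = from-yes (all? λ x → all? λ y → all? λ c → (x ⊖ c) ⊖ (y ⊖ c) ≟ x ⊖ y)

-- With equal differences the same x pass both filters. Only pointwise equations are used, so
-- function extensionality is avoided.
semiPlanar-resp-⊖ : ∀ f g → (∀ x z → g x ⊖ g z ≡ f x ⊖ f z) →
  SemiPlanar f → SemiPlanar g
semiPlanar-resp-⊖ f g g~f sp a a≢0 y =
  Sum.map (trans same) (trans same) (sp a a≢0 y)
  where
  same : length (solutions g a y) ≡ length (solutions f a y)
  same = cong length (filter-≐
    (λ x → g (x ⊕ a) ⊖ g x ≟ y) (λ x → f (x ⊕ a) ⊖ f x ≟ y)
    ((λ {x} → trans (sym (g~f (x ⊕ a) x))) , (λ {x} → trans (g~f (x ⊕ a) x)))
    (allFin 6))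

-- The value at 0 is omitted: it is always `zero`, which keeps the search at five free entries.
normalise : (ℤ₆ → ℤ₆) → Vec ℤ₆ 5
normalise f = tabulate λ i → f (suc i) ⊖ f zero

lookup-normalise : ∀ f x → lookup (zero ∷ normalise f) x ≡ f x ⊖ f zero
lookup-normalise f zero    = sym (⊖-self (f zero))
lookup-normalise f (suc i) = lookup∘tabulate (λ j → f (suc j) ⊖ f zero) i

-- The exhaustive search: `from-yes` has this type only because the decision procedure computes to
-- yes during type checking.
no-normalised-semiPlanar : ∀ (v : Vec ℤ₆ 5) → ¬ SemiPlanar (lookup (zero ∷ v))
no-normalised-semiPlanar =
  from-yes (allVec? 5 λ v → ¬? (semiPlanar? (lookup (zero ∷ v))))

theorem5 : ¬ (∃[ f ] SemiPlanar f)
theorem5 (f , sp) = no-normalised-semiPlanar (normalise f)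
  (semiPlanar-resp-⊖ f (lookup (zero ∷ normalise f)) differences sp)
  where
  differences : ∀ x z →
    lookup (zero ∷ normalise f) x ⊖ lookup (zero ∷ normalise f) z ≡ f x ⊖ f z
  differences x z = trans
    (cong₂ _⊖_ (lookup-normalise f x) (lookup-normalise f z))
    (⊖-translate (f x) (f z) (f zero))
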